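{- Let $n$ be odd and suppose $q=18n^2+1$ is a prime power. Let $x$ be a primitive $(3n)$-th root of unity in $\mathbb F_q$, and let $Y=(y_0,y_1,\dots,y_{3n-1})$ be a complete system of representatives for the cosets of $C^{3n}$ in $\mathbb F_q^*$ such that $\sum_{i=0}^{3n-1}y_i=0$, $\sum_{i=0}^{3n-1}x^iy_i=0$ and $\sum_{i=0}^{3n-1}x^{ -i}y_i=0$. Then there exists a $(9n^2,3n;4)$ Heffter net.
   Context: $C^{3n}$ denotes the subgroup of index $3n$ of $\mathbb F_q^*$ (the nonzero $3n$-th powers). A half-set of an abelian group $G$ of odd order $2v+1\ge7$ is a subset $V\subseteq G\setminus\{0\}$ containing exactly one element of each pair $\{g,-g\}$, $g\ne0$. A $(v,k)$ Heffter system on $V$ is a partition of $V$ into blocks of size $k$ each summing to $0$ in $G$. A $(k^2,k;r)$ Heffter net is a partial linear space (any two distinct points lie in at most one block) whose point set is a half-set $V$ of an abelian group of order $2k^2+1$, with a resolution of its blocks into $r$ parallel classes (each a partition of $V$), each of which is a $(k^2,k)$ Heffter system. -}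

module Defs where

open import Level using (Level; _⊔_; suc)
open import Algebra.Apartness.Bundles using (HeytingField; HeytingCommutativeRing)
open import Algebra.Bundles using (AbelianGroup; CommutativeRing)
open import Data.Fin.Base using (Fin)
open import Data.List.Base using (List; foldr; length)
import Data.List.Membership.Setoid as Membership
import Data.List.Relation.Unary.Unique.Setoid as Unique
open import Data.Nat.Base as ℕ using (ℕ)
open import Data.Nat.Primality using (Prime)
open import Data.Product using (Σ; ∃; ∃₂; ∃!; _×_; _,_)
open import Data.Sum.Base using (_⊎_)
open import Function.Bundles using (Inverse)
open import Relation.Binary.Bundles using (Setoid)
open import Relation.Binary.PropositionalEquality using (_≡_)
import Relation.Binary.PropositionalEquality as ≡
open import Relation.Nullary.Negation using (¬_)

private
  variable
    c ℓ ℓ₁ ℓ₂ : Level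

IsPrimePower : ℕ → Set
IsPrimePower q = ∃₂ λ p e → Prime p × 1 ℕ.≤ e × q ≡ p ℕ.^ e

HasOrder : Setoid c ℓ → ℕ → Set (c ⊔ ℓ)
HasOrder S n = Inverse S (≡.setoid (Fin n))

module FiniteSubsets (S : Setoid c ℓ) where
  open Setoid S using (Carrier; _≈_)
  open Membership S using () renaming (_∈_ to _∈ˡ_)
  open Unique S using (Unique)

  -- A finite subset is given by a repetition-free list of its elements; the
  -- order of the list is irrelevant to every notion below.
  record Subset : Set (c ⊔ ℓ) where
    field
      elements : List Carrier
      distinct : Unique elements

  open Subset public

  infix 4 _∈_

  _∈_ : Carrier → Subset → Set (c ⊔ ℓ)
  x ∈ A = x ∈ˡ elements A

  ∣_∣ : Subset → ℕ
  ∣ A ∣ = length (elements A)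

  -- Each point lies in the block of exactly one index. Hence nonempty blocks
  -- with different indices are automatically different as sets.
  IsPartition : ∀ {m} → Subset → (Fin m → Subset) → Set (c ⊔ ℓ)
  IsPartition V B =
    (∀ i {x} → x ∈ B i → x ∈ V) × (∀ {x} → x ∈ V → ∃! _≡_ λ i → x ∈ B i)

module Heffter (G : AbelianGroup c ℓ) where
  open AbelianGroup G using (Carrier; _≈_; _≉_)
    renaming (_∙_ to _+_; ε to 0#; _⁻¹ to -_; setoid to G-setoid)
  open FiniteSubsets G-setoid public

  record IsHalfSet (v : ℕ) (V : Subset) : Set (c ⊔ ℓ) where
    field
      order    : HasOrder G-setoid (2 ℕ.* v ℕ.+ 1)
      order≥7  : 7 ℕ.≤ 2 ℕ.* v ℕ.+ 1
      nonzero  : ∀ {g} → g ∈ V → g ≉ 0#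
      one-of-± : ∀ {g} → g ≉ 0# → (g ∈ V ⊎ - g ∈ V) × ¬ (g ∈ V × - g ∈ V)

  blockSum : Subset → Carrier
  blockSum A = foldr _+_ 0# (elements A)

  record HeffterSystem (v k : ℕ) (V : Subset) : Set (c ⊔ ℓ) where
    field
      isHalfSet : IsHalfSet v V
      {size}    : ℕ
      block     : Fin size → Subset
      partition : IsPartition V block
      blockSize : ∀ i → ∣ block i ∣ ≡ k
      zeroSum   : ∀ i → blockSum (block i) ≈ 0#

  open HeffterSystem public

-- The blocks of a (k², k; r) net are indexed by pairs (parallel class, block of
-- that class). Linearity compares these indices, so blocks with at least two
-- points are also distinct across different parallel classes.
record HeffterNet (c ℓ : Level) (v k r : ℕ) : Set (suc (c ⊔ ℓ)) where
  field
    group : AbelianGroup c ℓ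

  open AbelianGroup group using (Carrier; _≉_)
  open Heffter group

  field
    v≡k²    : v ≡ k ℕ.^ 2
    V       : Subset
    halfSet : IsHalfSet v V
    class   : Fin r → HeffterSystem v k V

  Block : Set
  Block = Σ (Fin r) λ j → Fin (size (class j))

  _∈ᵇ_ : Carrier → Block → Set (c ⊔ ℓ)
  x ∈ᵇ (j , i) = x ∈ block (class j) i

  field
    linear : ∀ {x y} → x ≉ y → ∀ (B B′ : Block) →
             x ∈ᵇ B → y ∈ᵇ B → x ∈ᵇ B′ → y ∈ᵇ B′ → B ≡ B′

-- The equality of a field of order q is decidable, and there x # y and x ≉ y
-- agree; "nonzero" is expressed by ≉ 0# throughout.
module FieldNotions (F : HeytingField c ℓ₁ ℓ₂) where
  open HeytingField F public using (Carrier; _≈_; _*_; 0#; 1#; heytingCommutativeRing)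
  open HeytingCommutativeRing heytingCommutativeRing public using (commutativeRing)
  open CommutativeRing commutativeRing public using (_≉_; setoid; semiring; +-monoid)
  open import Algebra.Properties.Semiring.Exp semiring public using (_^_)
  open import Algebra.Properties.Monoid.Sum +-monoid public using (sum)

  IsPrimitiveRootOfUnity : ℕ → Carrier → Set ℓ₁
  IsPrimitiveRootOfUnity m x =
    x ^ m ≈ 1# × (∀ j → 0 ℕ.< j → j ℕ.< m → x ^ j ≉ 1#)

  NonzeroPower : ℕ → Carrier → Set (c ⊔ ℓ₁)
  NonzeroPower m a = ∃ λ z → z ≉ 0# × a ≈ z ^ m

  IsCosetRepresentatives : (m : ℕ) → (Fin m → Carrier) → Set (c ⊔ ℓ₁)
  IsCosetRepresentatives m y =
    (∀ i → y i ≉ 0#) ×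
    (∀ g → g ≉ 0# →
      ∃! _≡_ λ i → ∃ λ a → NonzeroPower m a × g ≈ y i * a)

module Submission where

-- Write k = 3n, so that q = 2k² + 1. By Fermat every k-th power w ≠ 0 satisfies
-- w²ᵏ = 1, hence wᵏ = 1 or (−w)ᵏ = 1 since k is odd, and w = ± xʲ. So the 2k² elements
-- ± yᵢ xʲ exhaust the 2k² nonzero elements of the field; they are therefore distinct,
-- and V = { yᵢ xʲ } is a half-set. The four parallel classes are the rows { yᵢ xᵗ : t },
-- whose sums are geometric, and for each slope u = 1, x, x⁻¹ the blocks { yₜ uᵗ xʲ : t },
-- whose sums are the three hypotheses times xʲ. A row meets every block of slope u in
-- one point, and two blocks of distinct slopes u, u′ meet at most once because
-- (u/u′)ᵗ determines t mod k; for u/u′ = x² this again uses that k is odd.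

open import Defs
open import Algebra.Apartness.Bundles using (HeytingField)
open import Algebra.Bundles using (CommutativeMonoid; CommutativeRing; Semiring)
open import Data.Fin.Base using (Fin; zero; suc; toℕ; punchIn; punchOut; combine; remQuot)
open import Data.Fin.Permutation using (Permutation; permutation; _⟨$⟩ʳ_)
import Data.Fin.Properties as Fin
open import Data.Fin.Patterns using (0F; 1F; 2F)
open import Data.List.Base using (foldr; tabulate)
open import Data.List.Properties using (length-tabulate)
import Data.List.Membership.Setoid.Properties as Membershipₚ
import Data.List.Relation.Unary.Unique.Setoid.Properties as Uniqueₚ
open import Data.Nat.Base as ℕ using (ℕ; zero; suc)
open import Data.Nat.DivMod using (_/_; _%_; m≡m%n+[m/n]*n)
import Data.Nat.Properties as ℕ
open import Data.Nat.Tactic.RingSolver using (solve-∀)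
open import Data.Product using (∃; _×_; _,_; proj₁; proj₂; uncurry)
open import Data.Sum.Base using (_⊎_; inj₁; inj₂)
open import Data.Vec.Functional as Vector using (replicate)
open import Function.Base using (_∘_)
open import Function.Bundles using (Inverse)
open import Function.Definitions using (Injective)
open import Level using (_⊔_)
open import Relation.Binary.Bundles using (Setoid)
open import Relation.Binary.Definitions using (Decidable)
open import Relation.Binary.PropositionalEquality as ≡ using (_≡_; _≢_)
open import Relation.Nullary.Decidable using (yes; no; map′)
open import Relation.Nullary.Negation using (¬_; contradiction)

-- Pigeonhole principle and coverings of finite sets.

-- If f missed i, then punching out i would inject a set of n+1 elements into one of n elements.
injective⇒surjective : ∀ {n} {f : Fin n → Fin n} → Injective _≡_ _≡_ f →
                       ∀ i → ∃ λ j → f j ≡ i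
injective⇒surjective {suc n} {f} f-inj i with Fin.any? (λ j → f j Fin.≟ i)
... | yes i∈f = i∈f
... | no  i∉f = contradiction (Fin.injective⇒≤ avoid-injective) (ℕ.<⇒≱ ℕ.≤-refl)
  where
  i≢f : ∀ j → i ≢ f j
  i≢f j i≡fj = i∉f (j , ≡.sym i≡fj)

  avoid-injective : Injective _≡_ _≡_ (λ j → punchOut (i≢f j))
  avoid-injective eq = f-inj (Fin.punchOut-injective (i≢f _) (i≢f _) eq)

injective⇒permutation : ∀ {n} (f : Fin n → Fin n) → Injective _≡_ _≡_ f →
                        Permutation n n
injective⇒permutation f f-inj =
  permutation f f⁻¹ f∘f⁻¹ (λ i → f-inj (f∘f⁻¹ (f i)))
  where
  f⁻¹ = proj₁ ∘ injective⇒surjective f-inj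
  f∘f⁻¹ = proj₂ ∘ injective⇒surjective f-inj

module _ {c ℓ} (S : Setoid c ℓ) where
  open Setoid S

  -- Counting argument: choosing for each i a place of f i in the list g gives an injective σ, hence
  -- a bijective one. So g is f rearranged and inherits the absence of repetitions.
  covering⇒injective : ∀ {n} {f g : Fin n → Carrier} → (∀ {i j} → f i ≈ f j → i ≡ j) →
                       (∀ i → ∃ λ t → f i ≈ g t) → ∀ {s t} → g s ≈ g t → s ≡ t
  covering⇒injective {n} {f} {g} f-inj cover {s} {t} gs≈gt = begin
    s                   ≡⟨ proj₂ (surj s) ⟨
    σ (proj₁ (surj s))  ≡⟨ ≡.cong σ (f-inj eq) ⟩
    σ (proj₁ (surj t))  ≡⟨ proj₂ (surj t) ⟩
    t                   ∎
    where
    open ≡.≡-Reasoning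
    σ : Fin n → Fin n
    σ = proj₁ ∘ cover

    f≈g∘σ : ∀ i → f i ≈ g (σ i)
    f≈g∘σ = proj₂ ∘ cover

    σ-inj : Injective _≡_ _≡_ σ
    σ-inj {i} {j} σi≡σj = f-inj
      (trans (f≈g∘σ i) (trans (reflexive (≡.cong g σi≡σj)) (sym (f≈g∘σ j))))

    surj = injective⇒surjective σ-inj

    f≈g : ∀ t → f (proj₁ (surj t)) ≈ g t
    f≈g t = trans (f≈g∘σ _) (reflexive (≡.cong g (proj₂ (surj t))))

    eq : f (proj₁ (surj s)) ≈ f (proj₁ (surj t))
    eq = trans (f≈g s) (trans gs≈gt (sym (f≈g t)))

-- Sums invariant under translation.

module _ {c ℓ} (M : CommutativeMonoid c ℓ) where
  open CommutativeMonoid M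
  open import Algebra.Properties.CommutativeMonoid.Sum M
  open import Algebra.Definitions.RawMonoid rawMonoid using () renaming (_×_ to _·_)
  open import Relation.Binary.Reasoning.Setoid setoid

  -- If translation by a maps the list f into itself, it permutes f.
  sum-translate : ∀ {n} (f : Fin n → Carrier) (a : Carrier) →
                  (∀ {i j} → a ∙ f i ≈ a ∙ f j → i ≡ j) →
                  (∀ i → ∃ λ j → f j ≈ a ∙ f i) → sum f ≈ (n · a) ∙ sum f
  sum-translate {n} f a inj closed = begin
    sum f                                ≈⟨ sum-permute f π ⟩
    sum (λ i → f (π ⟨$⟩ʳ i))             ≈⟨ sum-cong-≋ (proj₂ ∘ closed) ⟩
    sum (λ i → a ∙ f i)                  ≈⟨ ∑-distrib-+ (replicate n a) f ⟩
    sum (replicate n a) ∙ sum f          ≈⟨ ∙-congʳ (sum-replicate n) ⟩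
    (n · a) ∙ sum f                      ∎
    where
    σ = proj₁ ∘ closed
    σ-inj : Injective _≡_ _≡_ σ
    σ-inj {i} {j} eq = inj (trans (sym (proj₂ (closed i)))
      (trans (reflexive (≡.cong f eq)) (proj₂ (closed j))))
    π = injective⇒permutation σ σ-inj

-- Cancellation in commutative rings without zero divisors.

-- An implication rather than a disjunction: this form comes straight from a tight apartness and is
-- the one that cancellation uses.
NoZeroDivisors : ∀ {c ℓ} → CommutativeRing c ℓ → Set (c ⊔ ℓ)
NoZeroDivisors R = ∀ {a b} → a ≉ 0# → a * b ≈ 0# → b ≈ 0#
  where open CommutativeRing R

module Domain {c ℓ} (R : CommutativeRing c ℓ)
  (no-zero-divisors : NoZeroDivisors R) where

  open CommutativeRing R hiding (zero)
  open import Algebra.Properties.Ring ring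
  open import Algebra.Properties.Semiring.Exp semiring
  open import Algebra.Properties.CommutativeSemiring.Exp commutativeSemiring using (^-distrib-*)
  open import Algebra.Properties.Semiring.Mult semiring using () renaming (_×_ to _·_)
  open import Algebra.Properties.Semiring.Sum semiring
  open import Algebra.Definitions.RawSemiring (Semiring.rawSemiring semiring) using (product)
  open import Relation.Binary.Reasoning.Setoid setoid

  *-cancelˡ-≉0 : ∀ {a b c} → a ≉ 0# → a * b ≈ a * c → b ≈ c
  *-cancelˡ-≉0 {a} {b} {c} a≉0 ab≈ac = x∙y⁻¹≈ε⇒x≈y b c (no-zero-divisors a≉0 (begin
    a * (b - c)     ≈⟨ x[y-z]≈xy-xz a b c ⟩
    a * b - a * c   ≈⟨ x≈y⇒x∙y⁻¹≈ε ab≈ac ⟩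
    0#              ∎))

  *-≉0 : ∀ {a b} → a ≉ 0# → b ≉ 0# → a * b ≉ 0#
  *-≉0 a≉0 b≉0 ab≈0 = b≉0 (no-zero-divisors a≉0 ab≈0)

  1^n≈1 : ∀ n → 1# ^ n ≈ 1#
  1^n≈1 zero    = refl
  1^n≈1 (suc n) = trans (*-identityˡ _) (1^n≈1 n)

  product-≉0 : ∀ {n} → 1# ≉ 0# → (f : Fin n → Carrier) → (∀ i → f i ≉ 0#) → product f ≉ 0#
  product-≉0 {zero}  1≉0 f f≉0 = 1≉0
  product-≉0 {suc n} 1≉0 f f≉0 = *-≉0 (f≉0 zero) (product-≉0 1≉0 (f ∘ suc) (f≉0 ∘ suc))

  -- Geometric sums and roots of unity.

  geometricSum : ℕ → Carrier → Carrier
  geometricSum k u = ∑[ i < k ] (u ^ toℕ i)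

  -- Both sides are 1 + u + ... + uᵏ, with the first or the last term split off. Avoiding
  -- subtraction keeps the induction simple.
  geometricSum-telescopes : ∀ k u → 1# + u * geometricSum k u ≈ geometricSum k u + u ^ k
  geometricSum-telescopes zero    u = trans (+-congˡ (zeroʳ u)) (+-comm 1# 0#)
  geometricSum-telescopes (suc k) u = begin
    1# + u * geometricSum (suc k) u         ≈⟨ +-congˡ (*-congˡ (+-congˡ shift)) ⟩
    1# + u * (1# + u * geometricSum k u)    ≈⟨ +-congˡ (*-congˡ (geometricSum-telescopes k u)) ⟩
    1# + u * (geometricSum k u + u ^ k)     ≈⟨ +-congˡ (distribˡ u _ _) ⟩
    1# + (u * geometricSum k u + u * u ^ k) ≈⟨ +-assoc _ _ _ ⟨
    (1# + u * geometricSum k u) + u ^ suc k ≈⟨ +-congʳ (+-congˡ shift) ⟨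
    geometricSum (suc k) u + u ^ suc k      ∎
    where
    shift : ∑[ i < k ] (u * u ^ toℕ i) ≈ u * geometricSum k u
    shift = sym (*-distribˡ-sum {k} u (λ i → u ^ toℕ i))

  -- By telescoping, uᵏ = 1 gives (u - 1) g = 0 for the sum g, and u - 1 cancels.
  geometricSum-root : ∀ k {u} → u ≉ 1# → u ^ k ≈ 1# → geometricSum k u ≈ 0#
  geometricSum-root k {u} u≉1 uᵏ≈1 = no-zero-divisors u-1≉0 (begin
    (u - 1#) * g          ≈⟨ [y-z]x≈yx-zx g u 1# ⟩
    u * g - 1# * g        ≈⟨ x≈y⇒x∙y⁻¹≈ε (+-cancelˡ 1# _ _ eq) ⟩
    0#                    ∎)
    where
    g = geometricSum k u
    u-1≉0 : u - 1# ≉ 0#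
    u-1≉0 eq = u≉1 (x∙y⁻¹≈ε⇒x≈y u 1# eq)
    eq : 1# + u * g ≈ 1# + 1# * g
    eq = begin
      1# + u * g    ≈⟨ geometricSum-telescopes k u ⟩
      g + u ^ k     ≈⟨ +-cong (sym (*-identityˡ g)) uᵏ≈1 ⟩
      1# * g + 1#   ≈⟨ +-comm _ _ ⟩
      1# + 1# * g   ∎

  -- Otherwise ∑ⱼ ∑ₘ (w xʲ)ᵐ vanishes term by term in j, although its inner sums
  -- ∑ⱼ wᵐ xᵐʲ contribute k for m = 0 and 0 for 0 < m < k.
  root-of-unity-inverse :
    Decidable _≈_ → ∀ {k x w} → k · 1# ≉ 0# → x ^ k ≈ 1# →
    (∀ j → 0 ℕ.< j → j ℕ.< k → x ^ j ≉ 1#) → w ^ k ≈ 1# →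
    ∃ λ (j : Fin k) → w * x ^ toℕ j ≈ 1#
  root-of-unity-inverse _≟_ {zero} k≉0 xᵏ≈1 xʲ≉1 wᵏ≈1 = contradiction refl k≉0
  root-of-unity-inverse _≟_ {suc k-1} {x} {w} k≉0 xᵏ≈1 xʲ≉1 wᵏ≈1
    with Fin.any? (λ (j : Fin (suc k-1)) → (w * x ^ toℕ j) ≟ 1#)
  ... | yes found = found
  ... | no  none  = contradiction k≈0 k≉0
    where
    k = suc k-1

    ^-comm : ∀ a m n → (a ^ m) ^ n ≈ (a ^ n) ^ m
    ^-comm a m n = begin
      (a ^ m) ^ n    ≈⟨ ^-assocʳ a m n ⟩
      a ^ (m ℕ.* n)  ≈⟨ ^-congʳ a (ℕ.*-comm m n) ⟩
      a ^ (n ℕ.* m)  ≈⟨ ^-assocʳ a n m ⟨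
      (a ^ n) ^ m    ∎

    root-^ : ∀ m → (x ^ m) ^ k ≈ 1#
    root-^ m = begin
      (x ^ m) ^ k  ≈⟨ ^-comm x m k ⟩
      (x ^ k) ^ m  ≈⟨ ^-congˡ m xᵏ≈1 ⟩
      1# ^ m       ≈⟨ 1^n≈1 m ⟩
      1#           ∎

    row : (j : Fin k) → geometricSum k (w * x ^ toℕ j) ≈ 0#
    row j = geometricSum-root k (λ eq → none (j , eq)) (begin
      (w * x ^ toℕ j) ^ k         ≈⟨ ^-distrib-* w (x ^ toℕ j) k ⟩
      w ^ k * (x ^ toℕ j) ^ k     ≈⟨ *-cong wᵏ≈1 (root-^ (toℕ j)) ⟩
      1# * 1#                     ≈⟨ *-identityˡ 1# ⟩
      1#                          ∎)

    column : ℕ → Carrier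
    column m = ∑[ j < k ] ((w * x ^ toℕ j) ^ m)

    column-geometric : ∀ m → column m ≈ w ^ m * geometricSum k (x ^ m)
    column-geometric m = begin
      column m                                       ≈⟨ sum-cong-≋ {k} (λ j → trans (^-distrib-* w (x ^ toℕ j) m) (*-congˡ (^-comm x (toℕ j) m))) ⟩
      ∑[ j < k ] (w ^ m * (x ^ m) ^ toℕ j)           ≈⟨ *-distribˡ-sum {k} (w ^ m) (λ j → (x ^ m) ^ toℕ j) ⟨
      w ^ m * geometricSum k (x ^ m)                 ∎

    column≈0 : (m : Fin k-1) → column (suc (toℕ m)) ≈ 0#
    column≈0 m = begin
      column m′                         ≈⟨ column-geometric m′ ⟩
      w ^ m′ * geometricSum k (x ^ m′)  ≈⟨ *-congˡ (geometricSum-root k (xʲ≉1 m′ (ℕ.s≤s ℕ.z≤n) (ℕ.s≤s (Fin.toℕ<n m))) (root-^ m′)) ⟩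
      w ^ m′ * 0#                       ≈⟨ zeroʳ _ ⟩
      0#                                ∎
      where m′ = suc (toℕ m)

    k≈0 : k · 1# ≈ 0#
    k≈0 = begin
      k · 1#                                                 ≈⟨ sum-replicate k ⟨
      column 0                                               ≈⟨ +-identityʳ _ ⟨
      column 0 + 0#                                          ≈⟨ +-congˡ (trans (sum-cong-≋ {k-1} column≈0) (sum-replicate-zero k-1)) ⟨
      ∑[ m < k ] column (toℕ m)                              ≈⟨ ∑-comm {k} {k} (λ j m → (w * x ^ toℕ j) ^ toℕ m) ⟨
      ∑[ j < k ] geometricSum k (w * x ^ toℕ j)              ≈⟨ sum-cong-≋ {k} row ⟩
      ∑[ j < k ] 0#                                          ≈⟨ sum-replicate-zero k ⟩
      0#                                                     ∎

  -- The inverse of w is wᵏ⁻¹, again a k-th root of unity; `root-of-unity-inverse` is applied to it.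
  root-of-unity : Decidable _≈_ → ∀ {k x w} → k · 1# ≉ 0# → x ^ k ≈ 1# →
    (∀ j → 0 ℕ.< j → j ℕ.< k → x ^ j ≉ 1#) → w ^ k ≈ 1# →
    ∃ λ (j : Fin k) → w ≈ x ^ toℕ j
  root-of-unity _≟_ {zero} k≉0 xᵏ≈1 xʲ≉1 wᵏ≈1 = contradiction refl k≉0
  root-of-unity _≟_ {suc k-1} {x} {w} k≉0 xᵏ≈1 xʲ≉1 wᵏ≈1 =
    let j , w′xʲ≈1 = root-of-unity-inverse _≟_ k≉0 xᵏ≈1 xʲ≉1 w′ᵏ≈1
    in j , (begin
      w                          ≈⟨ *-identityʳ w ⟨
      w * 1#                     ≈⟨ *-congˡ w′xʲ≈1 ⟨
      w * (w ^ k-1 * x ^ toℕ j)  ≈⟨ *-assoc _ _ _ ⟨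
      w ^ k * x ^ toℕ j          ≈⟨ *-congʳ wᵏ≈1 ⟩
      1# * x ^ toℕ j             ≈⟨ *-identityˡ _ ⟩
      x ^ toℕ j                  ∎)
    where
    k = suc k-1
    w′ᵏ≈1 : (w ^ k-1) ^ k ≈ 1#
    w′ᵏ≈1 = begin
      (w ^ k-1) ^ k     ≈⟨ ^-assocʳ w k-1 k ⟩
      w ^ (k-1 ℕ.* k)   ≈⟨ ^-congʳ w (ℕ.*-comm k-1 k) ⟩
      w ^ (k ℕ.* k-1)   ≈⟨ ^-assocʳ w k k-1 ⟨
      (w ^ k) ^ k-1     ≈⟨ ^-congˡ k-1 wᵏ≈1 ⟩
      1# ^ k-1          ≈⟨ 1^n≈1 k-1 ⟩
      1#                ∎

  -- Finite domains and Fermat's theorem.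

  module Finite {m} (order : HasOrder setoid (suc m)) where
    open Inverse order using (to; from; to-cong; strictlyInverseˡ; strictlyInverseʳ)

    _≟_ : Decidable _≈_
    a ≟ b = map′ to-injective to-cong (to a Fin.≟ to b)
      where
      to-injective : to a ≡ to b → a ≈ b
      to-injective eq = trans (sym (strictlyInverseʳ a))
        (trans (reflexive (≡.cong from eq)) (strictlyInverseʳ b))

    from-injective : ∀ {i j} → from i ≈ from j → i ≡ j
    from-injective {i} {j} eq = ≡.trans (≡.sym (strictlyInverseˡ i))
      (≡.trans (to-cong eq) (strictlyInverseˡ j))

    -- Adding 1 permutes all elements, so their sum S satisfies S = q·1 + S, where q is the order.
    order·1≈0 : suc m · 1# ≈ 0#
    order·1≈0 = sym (+-cancelʳ (sum from) _ _ (trans (+-identityˡ _)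
      (sum-translate +-commutativeMonoid from 1#
        (λ eq → from-injective (+-cancelˡ 1# _ _ eq))
        (λ i → to (1# + from i) , strictlyInverseʳ _))))

    unit : Fin m → Carrier
    unit i = from (punchIn (to 0#) i)

    unit≉0 : ∀ i → unit i ≉ 0#
    unit≉0 i eq = Fin.punchInᵢ≢i (to 0#) i
      (≡.trans (≡.sym (strictlyInverseˡ _)) (to-cong eq))

    unit-injective : ∀ {i j} → unit i ≈ unit j → i ≡ j
    unit-injective eq = Fin.punchIn-injective (to 0#) _ _ (from-injective eq)

    unit-index : ∀ {g} → g ≉ 0# → ∃ λ i → unit i ≈ g
    unit-index {g} g≉0 = punchOut 0≢g ,
      trans (reflexive (≡.cong from (Fin.punchIn-punchOut 0≢g))) (strictlyInverseʳ g)
      where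
      0≢g : to 0# ≢ to g
      0≢g eq = g≉0 (trans (sym (strictlyInverseʳ g))
        (trans (reflexive (≡.cong from (≡.sym eq))) (strictlyInverseʳ 0#)))

    -- Multiplication by z permutes the m nonzero elements, so their product P satisfies P = zᵐ P,
    -- and P ≠ 0 cancels. This is `sum-translate` in the multiplicative monoid, whose sums are
    -- products and whose multiples are powers.
    fermat : ∀ {z} → z ≉ 0# → z ^ m ≈ 1#
    fermat {z} z≉0 = sym (*-cancelˡ-≉0 (product-≉0 1≉0 unit unit≉0) (begin
      product unit * 1#     ≈⟨ *-identityʳ _ ⟩
      product unit          ≈⟨ sum-translate *-commutativeMonoid unit z
                                 (λ eq → unit-injective (*-cancelˡ-≉0 z≉0 eq))
                                 (λ i → unit-index (*-≉0 z≉0 (unit≉0 i))) ⟩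
      z ^ m * product unit  ≈⟨ *-comm _ _ ⟩
      product unit * z ^ m  ∎))
      where
      1≉0 : 1# ≉ 0#
      1≉0 1≈0 = z≉0 (begin
        z       ≈⟨ *-identityʳ z ⟨
        z * 1#  ≈⟨ *-congˡ 1≈0 ⟩
        z * 0#  ≈⟨ zeroʳ z ⟩
        0#      ∎)

-- Finite subsets as images of injective families.

module Image {c ℓ} (S : Setoid c ℓ) where
  open Setoid S
  open FiniteSubsets S

  image : ∀ {n} (f : Fin n → Carrier) → (∀ {i j} → f i ≈ f j → i ≡ j) → Subset
  image f f-inj = record { elements = tabulate f ; distinct = Uniqueₚ.tabulate⁺ S f-inj }

  ∈-image⁺ : ∀ {n} {f : Fin n → Carrier} {f-inj : ∀ {i j} → f i ≈ f j → i ≡ j} {g} →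
             (∃ λ i → g ≈ f i) → g ∈ image f f-inj
  ∈-image⁺ {f-inj = f-inj} (i , g≈fi) = Membershipₚ.∈-resp-≈ S (sym g≈fi) (Membershipₚ.∈-tabulate⁺ S i)

  ∈-image⁻ : ∀ {n} {f : Fin n → Carrier} {f-inj : ∀ {i j} → f i ≈ f j → i ≡ j} {g} →
             g ∈ image f f-inj → ∃ λ i → g ≈ f i
  ∈-image⁻ = Membershipₚ.∈-tabulate⁻ S

-- Links `blockSum`, a fold over a list, to `sum`, a fold over a family indexed by `Fin`.
foldr-tabulate : ∀ {a b} {A : Set a} {B : Set b} (_∙_ : A → B → B) (e : B) {n} (f : Fin n → A) →
                 foldr _∙_ e (tabulate f) ≡ Vector.foldr _∙_ e f
foldr-tabulate _∙_ e {zero}  f = ≡.refl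
foldr-tabulate _∙_ e {suc n} f = ≡.cong (f zero ∙_) (foldr-tabulate _∙_ e (f ∘ suc))

-- Square roots of 1, odd powers and signs.

module Net {c ℓ} (R : CommutativeRing c ℓ)
  (no-zero-divisors : NoZeroDivisors R) where

  open CommutativeRing R hiding (zero)
  open import Algebra.Properties.Ring ring
  open import Algebra.Properties.Semiring.Exp semiring
  open import Algebra.Properties.CommutativeSemiring.Exp commutativeSemiring using (^-distrib-*)
  open import Algebra.Properties.Semiring.Mult semiring using (×1-homo-*) renaming (_×_ to _·_)
  open import Algebra.Properties.Semiring.Sum semiring
  open import Algebra.Properties.CommutativeSemigroup *-commutativeSemigroup
    using (interchange; x∙yz≈yx∙z)
  open import Relation.Binary.Reasoning.Setoid setoid
  open Domain R no-zero-divisors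
  open Heffter +-abelianGroup
  open Image setoid

  -- Here (a - 1)(a + 1) = 0, and if a ≠ 1 the first factor cancels.
  square-root-of-1 : Decidable _≈_ → ∀ {a} → a * a ≈ 1# → a ≈ 1# ⊎ a ≈ - 1#
  square-root-of-1 _≟_ {a} a²≈1 with a ≟ 1#
  ... | yes a≈1 = inj₁ a≈1
  ... | no  a≉1 = inj₂ (+-inverseˡ-unique a 1# (no-zero-divisors
    (λ eq → a≉1 (x∙y⁻¹≈ε⇒x≈y a 1# eq)) (begin
      (a - 1#) * (a + 1#)            ≈⟨ [y-z]x≈yx-zx (a + 1#) a 1# ⟩
      a * (a + 1#) - 1# * (a + 1#)   ≈⟨ x≈y⇒x∙y⁻¹≈ε (begin
        a * (a + 1#)     ≈⟨ distribˡ a a 1# ⟩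
        a * a + a * 1#   ≈⟨ +-cong a²≈1 (*-identityʳ a) ⟩
        1# + a           ≈⟨ +-comm 1# a ⟩
        a + 1#           ≈⟨ *-identityˡ _ ⟨
        1# * (a + 1#)    ∎) ⟩
      0#                             ∎)))

  -a*-a≈a*a : ∀ a → - a * - a ≈ a * a
  -a*-a≈a*a a = begin
    - a * - a     ≈⟨ -‿distribˡ-* a (- a) ⟨
    - (a * - a)   ≈⟨ -‿cong (-‿distribʳ-* a a) ⟨
    - - (a * a)   ≈⟨ -‿involutive (a * a) ⟩
    a * a         ∎

  ^-odd : ∀ a h → a ^ suc (2 ℕ.* h) ≈ a * (a * a) ^ h
  ^-odd a h = *-congˡ (begin
    a ^ (2 ℕ.* h)   ≈⟨ ^-assocʳ a 2 h ⟨
    (a ^ 2) ^ h     ≈⟨ ^-congˡ h (*-congˡ (*-identityʳ a)) ⟩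
    (a * a) ^ h     ∎)

  ^-pred : ∀ a {k} → 0 ℕ.< k → a * a ^ ℕ.pred k ≈ a ^ k
  ^-pred a {suc k} _ = refl

  -- Write a²ʰ⁺¹ as a (a²)ʰ: the square does not see the sign, the single factor does.
  -a^odd : ∀ a {k} h → k ≡ suc (2 ℕ.* h) → (- a) ^ k ≈ - (a ^ k)
  -a^odd a h ≡.refl = begin
    (- a) ^ suc (2 ℕ.* h)       ≈⟨ ^-odd (- a) h ⟩
    - a * (- a * - a) ^ h       ≈⟨ *-congˡ (^-congˡ h (-a*-a≈a*a a)) ⟩
    - a * (a * a) ^ h           ≈⟨ -‿distribˡ-* a _ ⟨
    - (a * (a * a) ^ h)         ≈⟨ -‿cong (^-odd a h) ⟨
    - (a ^ suc (2 ℕ.* h))       ∎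

  -- Since k + 1 = 2(h + 1) is even, a = aᵏ⁺¹ is a power of a². Hence a is determined by its square.
  odd-root-from-square : ∀ {a k} h → k ≡ suc (2 ℕ.* h) → a ^ k ≈ 1# → (a * a) ^ suc h ≈ a
  odd-root-from-square {a} h ≡.refl aᵏ≈1 = begin
    (a * a) * (a * a) ^ h     ≈⟨ *-assoc a a _ ⟩
    a * (a * (a * a) ^ h)     ≈⟨ *-congˡ (^-odd a h) ⟨
    a * a ^ suc (2 ℕ.* h)     ≈⟨ *-congˡ aᵏ≈1 ⟩
    a * 1#                    ≈⟨ *-identityʳ a ⟩
    a                         ∎

  -- Signs are elements of `Fin 2` so that `combine` can index the signed points by a single finite
  -- number.
  ±_∙_ : Fin 2 → Carrier → Carrier
  ± 0F ∙ a = a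
  ± 1F ∙ a = - a

  *-± : ∀ s a b → a * (± s ∙ b) ≈ ± s ∙ (a * b)
  *-± 0F a b = refl
  *-± 1F a b = sym (-‿distribʳ-* a b)

  -- The construction for an odd k greater than 1; first the arithmetic of k in the ring.

  module _ (k h : ℕ) (k≡1+2h : k ≡ suc (2 ℕ.* h)) (1<k : 1 ℕ.< k)
    (v : ℕ) (v≡k² : v ≡ k ℕ.^ 2) (order : HasOrder setoid (2 ℕ.* v ℕ.+ 1))
    (x x⁻¹ : Carrier) (xᵏ≈1 : x ^ k ≈ 1#)
    (xʲ≉1 : ∀ j → 0 ℕ.< j → j ℕ.< k → x ^ j ≉ 1#) (x*x⁻¹≈1 : x * x⁻¹ ≈ 1#)
    (y : Fin k → Carrier) (y≉0 : ∀ i → y i ≉ 0#)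
    (coset : ∀ g → g ≉ 0# → ∃ λ i → ∃ λ z → z ≉ 0# × g ≈ y i * z ^ k)
    (Σy≈0 : sum y ≈ 0#)
    (Σxy≈0 : sum (λ i → x ^ toℕ i * y i) ≈ 0#)
    (Σx⁻¹y≈0 : sum (λ i → x⁻¹ ^ toℕ i * y i) ≈ 0#) where

    -- The right side fits `Finite` with m = k·(k·2), which is exactly the number of triples (i, j,
    -- sign).
    2v+1≡1+2k² : 2 ℕ.* v ℕ.+ 1 ≡ suc (k ℕ.* (k ℕ.* 2))
    2v+1≡1+2k² = ≡.trans (≡.cong (λ w → 2 ℕ.* w ℕ.+ 1) v≡k²) (lemma k)
      where
      lemma : ∀ k → 2 ℕ.* (k ℕ.* (k ℕ.* 1)) ℕ.+ 1 ≡ suc (k ℕ.* (k ℕ.* 2))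
      lemma = solve-∀

    open Finite (≡.subst (HasOrder setoid) 2v+1≡1+2k² order)

    0<k : 0 ℕ.< k
    0<k = ℕ.<⇒≤ 1<k

    x≉1 : x ≉ 1#
    x≉1 x≈1 = xʲ≉1 1 (ℕ.s≤s ℕ.z≤n) 1<k (trans (*-identityʳ x) x≈1)

    1≉0 : 1# ≉ 0#
    1≉0 1≈0 = x≉1 (begin
      x        ≈⟨ *-identityʳ x ⟨
      x * 1#   ≈⟨ *-congˡ 1≈0 ⟩
      x * 0#   ≈⟨ zeroʳ x ⟩
      0#       ≈⟨ 1≈0 ⟨
      1#       ∎)

    -- The order 1 + 2k² is 0 in the ring, so k = 0 there would leave 1 = 0.
    k≉0 : k · 1# ≉ 0#
    k≉0 k≈0 = 1≉0 (begin
      1#                              ≈⟨ +-identityʳ 1# ⟨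
      1# + 0#                         ≈⟨ +-congˡ (trans (×1-homo-* k (k ℕ.* 2)) (trans (*-congʳ k≈0) (zeroˡ _))) ⟨
      suc (k ℕ.* (k ℕ.* 2)) · 1#      ≈⟨ order·1≈0 ⟩
      0#                              ∎)

    -- The k-th roots of unity.

    -- Wrapping the equation in a record lets a be inferred from a proof of `Root a`.
    record Root (a : Carrier) : Set ℓ where
      constructor root
      field power≈1 : a ^ k ≈ 1#

    open Root

    1-root : Root 1#
    1-root = root (1^n≈1 k)

    *-root : ∀ {a b} → Root a → Root b → Root (a * b)
    *-root {a} {b} (root aᵏ≈1) (root bᵏ≈1) = root (begin
      (a * b) ^ k     ≈⟨ ^-distrib-* a b k ⟩
      a ^ k * b ^ k   ≈⟨ *-cong aᵏ≈1 bᵏ≈1 ⟩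
      1# * 1#         ≈⟨ *-identityˡ 1# ⟩
      1#              ∎)

    ^-root : ∀ {a} m → Root a → Root (a ^ m)
    ^-root zero    r = 1-root
    ^-root (suc m) r = *-root r (^-root m r)

    x^-root : ∀ m → Root (x ^ m)
    x^-root m = ^-root m (root xᵏ≈1)

    x⁻¹-root : Root x⁻¹
    x⁻¹-root = root (begin
      x⁻¹ ^ k             ≈⟨ *-identityˡ _ ⟨
      1# * x⁻¹ ^ k        ≈⟨ *-congʳ xᵏ≈1 ⟨
      x ^ k * x⁻¹ ^ k     ≈⟨ ^-distrib-* x x⁻¹ k ⟨
      (x * x⁻¹) ^ k       ≈⟨ ^-congˡ k x*x⁻¹≈1 ⟩
      1# ^ k              ≈⟨ 1^n≈1 k ⟩
      1#                  ∎)

    root≉0 : ∀ {a} → Root a → a ≉ 0#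
    root≉0 {a} (root aᵏ≈1) a≈0 = 1≉0 (begin
      1#                 ≈⟨ aᵏ≈1 ⟨
      a ^ k              ≈⟨ ^-pred a 0<k ⟨
      a * a ^ ℕ.pred k   ≈⟨ *-congʳ a≈0 ⟩
      0# * a ^ ℕ.pred k  ≈⟨ zeroˡ _ ⟩
      0#                 ∎)

    root⇒power : ∀ {a} → Root a → ∃ λ (j : Fin k) → a ≈ x ^ toℕ j
    root⇒power (root aᵏ≈1) = root-of-unity _≟_ k≉0 xᵏ≈1 xʲ≉1 aᵏ≈1

    -- The power aᵏ squares to 1, so it is 1 or -1. In the second case -a is a k-th root of unity
    -- because k is odd.
    unity-2k⇒±power : ∀ {a} → a ^ k * a ^ k ≈ 1# →
                      ∃ λ (j : Fin k) → ∃ λ s → a ≈ ± s ∙ (x ^ toℕ j)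
    unity-2k⇒±power {a} a²ᵏ≈1 with square-root-of-1 _≟_ a²ᵏ≈1
    ... | inj₁ aᵏ≈1 = let j , a≈xʲ = root⇒power (root aᵏ≈1) in j , 0F , a≈xʲ
    ... | inj₂ aᵏ≈-1 =
      let j , -a≈xʲ = root⇒power {a = - a} (root (begin
            (- a) ^ k   ≈⟨ -a^odd a h k≡1+2h ⟩
            - (a ^ k)   ≈⟨ -‿cong aᵏ≈-1 ⟩
            - - 1#      ≈⟨ -‿involutive 1# ⟩
            1#          ∎))
      in j , 1F , trans (sym (-‿involutive a)) (-‿cong -a≈xʲ)

    -- The points and their negatives.

    point : Fin k → Fin k → Carrier
    point i j = y i * x ^ toℕ j

    -- The coset of g supplies g = yᵢ zᵏ, and zᵏ is a 2k-th root of unity by `fermat`, since z²ᵏ² =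
    -- 1.
    nonzero⇒±point : ∀ {g} → g ≉ 0# → ∃ λ i → ∃ λ j → ∃ λ s → g ≈ ± s ∙ point i j
    nonzero⇒±point {g} g≉0 =
      let i , z , z≉0 , g≈yzᵏ = coset g g≉0
          j , s , zᵏ≈±xʲ = unity-2k⇒±power (z²ᵏ≈1 z≉0)
      in i , j , s , (begin
        g                            ≈⟨ g≈yzᵏ ⟩
        y i * z ^ k                  ≈⟨ *-congˡ zᵏ≈±xʲ ⟩
        y i * (± s ∙ (x ^ toℕ j))    ≈⟨ *-± s _ _ ⟩
        ± s ∙ point i j              ∎)
      where
      z²ᵏ≈1 : ∀ {z} → z ≉ 0# → (z ^ k) ^ k * (z ^ k) ^ k ≈ 1#
      z²ᵏ≈1 {z} z≉0 = begin
        (z ^ k) ^ k * (z ^ k) ^ k   ≈⟨ ^-homo-* (z ^ k) k k ⟨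
        (z ^ k) ^ (k ℕ.+ k)         ≈⟨ ^-congʳ (z ^ k) (k+k k) ⟩
        (z ^ k) ^ (k ℕ.* 2)         ≈⟨ ^-assocʳ z k (k ℕ.* 2) ⟩
        z ^ (k ℕ.* (k ℕ.* 2))       ≈⟨ fermat z≉0 ⟩
        1#                          ∎
        where
        k+k : ∀ k → k ℕ.+ k ≡ k ℕ.* 2
        k+k = solve-∀

    -- The 2k² elements ± yᵢ xʲ exhaust the 2k² nonzero elements, so they are distinct.
    ±point-injective : ∀ i j s i′ j′ s′ → ± s ∙ point i j ≈ ± s′ ∙ point i′ j′ →
                       i ≡ i′ × j ≡ j′ × s ≡ s′
    ±point-injective i j s i′ j′ s′ eq =
      let i≡i′ , js≡js′ = Fin.combine-injective i (combine j s) i′ (combine j′ s′)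
            (covering⇒injective setoid unit-injective cover
              (trans (±point-combine i j s) (trans eq (sym (±point-combine i′ j′ s′)))))
      in i≡i′ , Fin.combine-injective j s j′ s′ js≡js′
      where
      signed : Fin k → Fin k × Fin 2 → Carrier
      signed i (j , s) = ± s ∙ point i j

      ±point : Fin (k ℕ.* (k ℕ.* 2)) → Carrier
      ±point = uncurry (λ i → signed i ∘ remQuot 2) ∘ remQuot {k} (k ℕ.* 2)

      ±point-combine : ∀ i j s → ±point (combine i (combine j s)) ≈ ± s ∙ point i j
      ±point-combine i j s = reflexive (≡.trans
        (≡.cong (uncurry (λ i → signed i ∘ remQuot 2)) (Fin.remQuot-combine i (combine j s)))
        (≡.cong (signed i) (Fin.remQuot-combine j s)))

      cover : ∀ p → ∃ λ q → unit p ≈ ±point q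
      cover p = let i , j , s , eq = nonzero⇒±point (unit≉0 p)
                in combine i (combine j s) , trans eq (sym (±point-combine i j s))

    point-injective : ∀ i j i′ j′ → point i j ≈ point i′ j′ → i ≡ i′ × j ≡ j′
    point-injective i j i′ j′ eq =
      let i≡i′ , j≡j′ , _ = ±point-injective i j 0F i′ j′ 0F eq in i≡i′ , j≡j′

    -- Multiplying by a common yᵢ makes both powers points of one row. The index i = j is simply one
    -- at hand.
    power-injective : ∀ (j j′ : Fin k) → x ^ toℕ j ≈ x ^ toℕ j′ → j ≡ j′
    power-injective j j′ eq = proj₂ (point-injective j j j j′ (*-congˡ eq))

    -- This is `point-injective` without explicit exponents: the yᵢ lie in different cosets of the
    -- group of k-th roots of unity.
    y-root-injective : ∀ {i i′ a a′} → Root a → Root a′ → y i * a ≈ y i′ * a′ →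
                       i ≡ i′ × a ≈ a′
    y-root-injective {i} {i′} {a} {a′} ra ra′ eq =
      let j , a≈xʲ = root⇒power ra
          j′ , a′≈xʲ′ = root⇒power ra′
          i≡i′ , j≡j′ = point-injective i j i′ j′ (trans (*-congˡ (sym a≈xʲ)) (trans eq (*-congˡ a′≈xʲ′)))
      in i≡i′ , trans a≈xʲ (trans (^-congʳ x (≡.cong toℕ j≡j′)) (sym a′≈xʲ′))

    -- Slopes and their independence.

    slope : Fin 3 → Carrier
    slope 0F = 1#
    slope 1F = x
    slope 2F = x⁻¹

    slope-root : ∀ a → Root (slope a)
    slope-root 0F = 1-root
    slope-root 1F = root xᵏ≈1
    slope-root 2F = x⁻¹-root

    slope-sum : ∀ a → sum (λ i → slope a ^ toℕ i * y i) ≈ 0#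
    slope-sum 0F = trans (sum-cong-≋ (λ i → trans (*-congʳ (1^n≈1 (toℕ i))) (*-identityˡ (y i)))) Σy≈0
    slope-sum 1F = Σxy≈0
    slope-sum 2F = Σx⁻¹y≈0

    -- (u / u′)ᵗ = (u / u′)ˢ only for t = s.
    Independent : Carrier → Carrier → Set ℓ
    Independent u u′ = ∀ {t s : Fin k} →
      u ^ toℕ t * u′ ^ toℕ s ≈ u ^ toℕ s * u′ ^ toℕ t → t ≡ s

    independent-sym : ∀ {u u′} → Independent u u′ → Independent u′ u
    independent-sym ind eq = ind (trans (*-comm _ _) (trans (sym eq) (*-comm _ _)))

    1-x-independent : Independent 1# x
    1-x-independent {t} {s} eq = ≡.sym (power-injective s t (begin
      x ^ toℕ s               ≈⟨ *-identityˡ _ ⟨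
      1# * x ^ toℕ s          ≈⟨ *-congʳ (1^n≈1 (toℕ t)) ⟨
      1# ^ toℕ t * x ^ toℕ s  ≈⟨ eq ⟩
      1# ^ toℕ s * x ^ toℕ t  ≈⟨ *-congʳ (1^n≈1 (toℕ s)) ⟩
      1# * x ^ toℕ t          ≈⟨ *-identityˡ _ ⟩
      x ^ toℕ t               ∎))

    xᵐ*x⁻¹ᵐ≈1 : ∀ m → x ^ m * x⁻¹ ^ m ≈ 1#
    xᵐ*x⁻¹ᵐ≈1 m = begin
      x ^ m * x⁻¹ ^ m   ≈⟨ ^-distrib-* x x⁻¹ m ⟨
      (x * x⁻¹) ^ m     ≈⟨ ^-congˡ m x*x⁻¹≈1 ⟩
      1# ^ m            ≈⟨ 1^n≈1 m ⟩
      1#                ∎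

    -- Multiplying x⁻ˢ = x⁻ᵗ by xᵗ gives x⁻ˢ xᵗ = 1 = x⁻ˢ xˢ, and x⁻ˢ cancels.
    1-x⁻¹-independent : Independent 1# x⁻¹
    1-x⁻¹-independent {t} {s} eq = power-injective t s (*-cancelˡ-≉0 (root≉0 (^-root (toℕ s) x⁻¹-root)) (begin
      x⁻¹ ^ toℕ s * x ^ toℕ t      ≈⟨ *-congʳ (trans (sym (*-identityˡ _)) (*-congʳ (sym (1^n≈1 (toℕ t))))) ⟩
      1# ^ toℕ t * x⁻¹ ^ toℕ s * x ^ toℕ t   ≈⟨ *-congʳ eq ⟩
      1# ^ toℕ s * x⁻¹ ^ toℕ t * x ^ toℕ t   ≈⟨ *-congʳ (trans (*-congʳ (1^n≈1 (toℕ s))) (*-identityˡ _)) ⟩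
      x⁻¹ ^ toℕ t * x ^ toℕ t      ≈⟨ *-comm _ _ ⟩
      x ^ toℕ t * x⁻¹ ^ toℕ t      ≈⟨ xᵐ*x⁻¹ᵐ≈1 (toℕ t) ⟩
      1#                           ≈⟨ xᵐ*x⁻¹ᵐ≈1 (toℕ s) ⟨
      x ^ toℕ s * x⁻¹ ^ toℕ s      ≈⟨ *-comm _ _ ⟩
      x⁻¹ ^ toℕ s * x ^ toℕ s      ∎))

    -- The equation amounts to x²ᵗ = x²ˢ, and squaring is injective on roots of odd order.
    x-x⁻¹-independent : Independent x x⁻¹
    x-x⁻¹-independent {t} {s} eq = power-injective t s (begin
      X t                      ≈⟨ odd-root-from-square h k≡1+2h (power≈1 (x^-root (toℕ t))) ⟨
      (X t * X t) ^ suc h      ≈⟨ ^-congˡ (suc h) squares ⟩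
      (X s * X s) ^ suc h      ≈⟨ odd-root-from-square h k≡1+2h (power≈1 (x^-root (toℕ s))) ⟩
      X s                      ∎)
      where
      X X⁻¹ : Fin k → Carrier
      X t = x ^ toℕ t
      X⁻¹ t = x⁻¹ ^ toℕ t

      cancel : ∀ a t → a * X t * X⁻¹ t ≈ a
      cancel a t = trans (*-assoc _ _ _) (trans (*-congˡ (xᵐ*x⁻¹ᵐ≈1 (toℕ t))) (*-identityʳ a))

      squares : X t * X t ≈ X s * X s
      squares = begin
        X t * X t                        ≈⟨ *-congʳ (cancel (X t) s) ⟨
        X t * X s * X⁻¹ s * X t          ≈⟨ *-congʳ (trans (*-congʳ (*-comm _ _)) (*-assoc _ _ _)) ⟩
        X s * (X t * X⁻¹ s) * X t        ≈⟨ *-congʳ (*-congˡ eq) ⟩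
        X s * (X s * X⁻¹ t) * X t        ≈⟨ *-congʳ (*-assoc _ _ _) ⟨
        X s * X s * X⁻¹ t * X t          ≈⟨ *-assoc _ _ _ ⟩
        X s * X s * (X⁻¹ t * X t)        ≈⟨ *-congˡ (*-comm _ _) ⟩
        X s * X s * (X t * X⁻¹ t)        ≈⟨ *-assoc _ _ _ ⟨
        X s * X s * X t * X⁻¹ t          ≈⟨ cancel _ t ⟩
        X s * X s                        ∎

    slopes-independent : ∀ {a a′} → a ≢ a′ → Independent (slope a) (slope a′)
    slopes-independent {0F} {0F} a≢a′ = contradiction ≡.refl a≢a′
    slopes-independent {0F} {1F} a≢a′ = 1-x-independent
    slopes-independent {0F} {2F} a≢a′ = 1-x⁻¹-independent
    slopes-independent {1F} {0F} a≢a′ = independent-sym 1-x-independent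
    slopes-independent {1F} {1F} a≢a′ = contradiction ≡.refl a≢a′
    slopes-independent {1F} {2F} a≢a′ = x-x⁻¹-independent
    slopes-independent {2F} {0F} a≢a′ = independent-sym 1-x⁻¹-independent
    slopes-independent {2F} {1F} a≢a′ = independent-sym x-x⁻¹-independent
    slopes-independent {2F} {2F} a≢a′ = contradiction ≡.refl a≢a′

    -- The blocks as indexed families.

    -- Class `0F` holds the rows. In class `suc a` the entry at position t lies in row t, so a
    -- common point of two such blocks has the same position in both.
    line : Fin 4 → Fin k → Fin k → Carrier
    line 0F      i t = point i t
    line (suc a) j t = y t * (slope a ^ toℕ t * x ^ toℕ j)

    line-root : ∀ a (t j : Fin k) → Root (slope a ^ toℕ t * x ^ toℕ j)
    line-root a t j = *-root (^-root (toℕ t) (slope-root a)) (x^-root (toℕ j))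

    -- Serves twice: a block has no repetitions, and different blocks of one class are disjoint.
    line-injective : ∀ c b b′ t t′ → line c b t ≈ line c b′ t′ → b ≡ b′ × t ≡ t′
    line-injective 0F b b′ t t′ eq = point-injective b t b′ t′ eq
    line-injective (suc a) b b′ t t′ eq =
      let t≡t′ , eq′ = y-root-injective (line-root a t b) (line-root a t′ b′) eq
      -- The coset already gives t = t′, so the same factor uᵗ cancels and leaves xᵇ = xᵇ′.
      in power-injective b b′ (*-cancelˡ-≉0 (root≉0 (^-root (toℕ t) (slope-root a)))
           (trans eq′ (*-congʳ (^-congʳ (slope a) (≡.cong toℕ (≡.sym t≡t′)))))) , t≡t′

    line⇒point : ∀ c b t → ∃ λ i → ∃ λ j → line c b t ≈ point i j
    line⇒point 0F      b t = b , t , refl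
    line⇒point (suc a) b t = let j , eq = root⇒power (line-root a t b) in t , j , *-congˡ eq

    -- uⁱ has inverse (uⁱ)ᵏ⁻¹.
    point⇒line : ∀ c i j → ∃ λ b → ∃ λ t → point i j ≈ line c b t
    point⇒line 0F      i j = i , j , refl
    point⇒line (suc a) i j =
      let b , eq = root⇒power (*-root (^-root (ℕ.pred k) uⁱ-root) (x^-root (toℕ j)))
      in b , i , *-congˡ (begin
        x ^ toℕ j                              ≈⟨ *-identityˡ _ ⟨
        1# * x ^ toℕ j                         ≈⟨ *-congʳ (trans (^-pred uⁱ 0<k) (power≈1 uⁱ-root)) ⟨
        uⁱ * uⁱ ^ ℕ.pred k * x ^ toℕ j        ≈⟨ *-assoc _ _ _ ⟩
        uⁱ * (uⁱ ^ ℕ.pred k * x ^ toℕ j)      ≈⟨ *-congˡ eq ⟩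
        uⁱ * x ^ toℕ b                         ∎)
      where
      uⁱ = slope a ^ toℕ i
      uⁱ-root : Root uⁱ
      uⁱ-root = ^-root (toℕ i) (slope-root a)

    line-sum : ∀ c b → sum (line c b) ≈ 0#
    line-sum 0F b = begin
      ∑[ t < k ] (y b * x ^ toℕ t)  ≈⟨ *-distribˡ-sum {k} (y b) (λ t → x ^ toℕ t) ⟨
      y b * geometricSum k x        ≈⟨ *-congˡ (geometricSum-root k x≉1 xᵏ≈1) ⟩
      y b * 0#                      ≈⟨ zeroʳ _ ⟩
      0#                            ∎
    line-sum (suc a) b = begin
      ∑[ t < k ] (y t * (u ^ toℕ t * x ^ toℕ b))   ≈⟨ sum-cong-≋ {k} (λ t → x∙yz≈yx∙z (y t) (u ^ toℕ t) (x ^ toℕ b)) ⟩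
      ∑[ t < k ] (u ^ toℕ t * y t * x ^ toℕ b)     ≈⟨ *-distribʳ-sum {k} (x ^ toℕ b) (λ t → u ^ toℕ t * y t) ⟨
      ∑[ t < k ] (u ^ toℕ t * y t) * x ^ toℕ b     ≈⟨ *-congʳ (slope-sum a) ⟩
      0# * x ^ toℕ b                               ≈⟨ zeroˡ _ ⟩
      0#                                           ∎
      where u = slope a

    -- Two common points of blocks from different classes have the same position in the first block,
    -- so they coincide.
    line-transversal : ∀ {c c′} → c ≢ c′ → ∀ {b b′ t t′ s s′} →
      line c b t ≈ line c′ b′ t′ → line c b s ≈ line c′ b′ s′ → t ≡ s
    line-transversal {0F} {0F} c≢c′ eq-t eq-s = contradiction ≡.refl c≢c′
    line-transversal {0F} {suc a′} c≢c′ {b} {b′} {t} {t′} {s} {s′} eq-t eq-s =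
      -- Both points lie in row b, so both sit at position b of the sloped block.
      let b≡t′ , eq  = y-root-injective (x^-root (toℕ t)) (line-root a′ t′ b′) eq-t
          b≡s′ , eq′ = y-root-injective (x^-root (toℕ s)) (line-root a′ s′ b′) eq-s
          t′≡s′ = ≡.trans (≡.sym b≡t′) b≡s′
      in power-injective t s
        (trans eq (trans (*-congʳ (^-congʳ (slope a′) (≡.cong toℕ t′≡s′))) (sym eq′)))
    line-transversal {suc a} {0F} c≢c′ {b} {b′} {t} {t′} {s} {s′} eq-t eq-s =
      ≡.trans (proj₁ (y-root-injective (line-root a t b) (x^-root (toℕ t′)) eq-t))
        (≡.sym (proj₁ (y-root-injective (line-root a s b) (x^-root (toℕ s′)) eq-s)))
    line-transversal {suc a} {suc a′} c≢c′ {b} {b′} {t} {t′} {s} {s′} eq-t eq-s =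
      let t≡t′ , eq  = y-root-injective (line-root a t b) (line-root a′ t′ b′) eq-t
          s≡s′ , eq′ = y-root-injective (line-root a s b) (line-root a′ s′ b′) eq-s
      -- Multiplying the first equation by the second reversed gives uᵗ xᵇ · u′ˢ xᵇ′ = u′ᵗ xᵇ′ · uˢ
      -- xᵇ; cancelling xᵇ xᵇ′ leaves the equation that independence resolves.
      in slopes-independent (λ a≡a′ → c≢c′ (≡.cong suc a≡a′))
      (*-cancelˡ-≉0 (root≉0 (*-root (x^-root (toℕ b)) (x^-root (toℕ b′)))) (begin
        xᵇ * xᵇ′ * (u ^ toℕ t * u′ ^ toℕ s)      ≈⟨ *-comm _ _ ⟩
        u ^ toℕ t * u′ ^ toℕ s * (xᵇ * xᵇ′)      ≈⟨ interchange _ _ _ _ ⟩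
        u ^ toℕ t * xᵇ * (u′ ^ toℕ s * xᵇ′)      ≈⟨ *-cong eq (*-congʳ (^-congʳ u′ (≡.cong toℕ s≡s′))) ⟩
        u′ ^ toℕ t′ * xᵇ′ * (u′ ^ toℕ s′ * xᵇ′)  ≈⟨ *-cong (*-congʳ (^-congʳ u′ (≡.cong toℕ (≡.sym t≡t′)))) (sym eq′) ⟩
        u′ ^ toℕ t * xᵇ′ * (u ^ toℕ s * xᵇ)      ≈⟨ *-comm _ _ ⟩
        u ^ toℕ s * xᵇ * (u′ ^ toℕ t * xᵇ′)      ≈⟨ interchange _ _ _ _ ⟩
        u ^ toℕ s * u′ ^ toℕ t * (xᵇ * xᵇ′)      ≈⟨ *-comm _ _ ⟩
        xᵇ * xᵇ′ * (u ^ toℕ s * u′ ^ toℕ t)      ∎))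
      where
      u = slope a
      u′ = slope a′
      xᵇ = x ^ toℕ b
      xᵇ′ = x ^ toℕ b′

    -- The half-set V.

    points : Fin (k ℕ.* k) → Carrier
    points = uncurry point ∘ remQuot {k} k

    points-combine : ∀ i j → points (combine i j) ≈ point i j
    points-combine i j = reflexive (≡.cong (uncurry point) (Fin.remQuot-combine i j))

    points-injective : ∀ {p q} → points p ≈ points q → p ≡ q
    points-injective {p} {q} eq = let i≡i′ , j≡j′ = point-injective _ _ _ _ eq in
      ≡.trans (≡.sym (Fin.combine-remQuot {k} k p))
        (≡.trans (≡.cong₂ combine i≡i′ j≡j′) (Fin.combine-remQuot {k} k q))

    V : Subset
    V = image points points-injective

    ∈V⁺ : ∀ {g} i j → g ≈ point i j → g ∈ V
    ∈V⁺ i j eq = ∈-image⁺ {f-inj = points-injective}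
      (combine i j , trans eq (sym (points-combine i j)))

    ∈V⁻ : ∀ {g} → g ∈ V → ∃ λ i → ∃ λ j → g ≈ point i j
    ∈V⁻ g∈V = let p , eq = ∈-image⁻ {f-inj = points-injective} g∈V
                  i , j = remQuot {k} k p
              in i , j , eq

    -- One of g, -g lies in V because the signed points exhaust the nonzero elements. Both cannot,
    -- because signed points with different signs are different.
    V-isHalfSet : IsHalfSet v V
    V-isHalfSet = record
      { order    = order
      ; order≥7  = order≥7
      ; nonzero  = λ g∈V g≈0 → let i , j , g≈p = ∈V⁻ g∈V in
          *-≉0 (y≉0 i) (root≉0 (x^-root (toℕ j))) (trans (sym g≈p) g≈0)
      ; one-of-± = λ g≉0 → one g≉0 , λ (g∈V , -g∈V) → both g∈V -g∈V
      }
      where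
      order≥7 : 7 ℕ.≤ 2 ℕ.* v ℕ.+ 1
      -- From k ≥ 2 follows 2k² ≥ 8 = 6 + 2.
      order≥7 = ≡.subst (7 ℕ.≤_) (≡.sym 2v+1≡1+2k²)
        (ℕ.s≤s (ℕ.≤-trans (ℕ.m≤m+n 6 2) (ℕ.*-mono-≤ 1<k (ℕ.*-monoˡ-≤ 2 1<k))))

      one : ∀ {g} → g ≉ 0# → g ∈ V ⊎ - g ∈ V
      one {g} g≉0 = let i , j , s , g≈±p = nonzero⇒±point g≉0 in by-sign i j s g≈±p
        where
        by-sign : ∀ i j s → g ≈ ± s ∙ point i j → g ∈ V ⊎ - g ∈ V
        by-sign i j 0F g≈p  = inj₁ (∈V⁺ i j g≈p)
        by-sign i j 1F g≈-p = inj₂ (∈V⁺ i j (trans (-‿cong g≈-p) (-‿involutive _)))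

      both : ∀ {g} → g ∈ V → ¬ (- g ∈ V)
      both g∈V -g∈V =
        let i , j , g≈p = ∈V⁻ g∈V
            i′ , j′ , -g≈p′ = ∈V⁻ -g∈V
            _ , _ , 0≡1 = ±point-injective i j 0F i′ j′ 1F
              (trans (sym g≈p) (trans (sym (-‿involutive _)) (-‿cong -g≈p′)))
        in contradiction 0≡1 λ ()

    -- The parallel classes and linearity.

    block-of : Fin 4 → Fin k → Subset
    block-of c b = image (line c b) (λ {t} {t′} eq → proj₂ (line-injective c b b t t′ eq))

    ∈-block⁻ : ∀ {g} c b → g ∈ block-of c b → ∃ λ t → g ≈ line c b t
    ∈-block⁻ c b = ∈-image⁻ {f-inj = λ {t} {t′} eq → proj₂ (line-injective c b b t t′ eq)}

    block-unique : ∀ {g} c {b b′} → g ∈ block-of c b → g ∈ block-of c b′ → b ≡ b′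
    block-unique c {b} {b′} g∈b g∈b′ =
      let t , eq = ∈-block⁻ c b g∈b
          t′ , eq′ = ∈-block⁻ c b′ g∈b′
      in proj₁ (line-injective c b b′ t t′ (trans (sym eq) eq′))

    system : Fin 4 → HeffterSystem v k V
    system c = record
      { isHalfSet = V-isHalfSet
      ; block     = block-of c
      ; partition = sound , λ g∈V →
          let b , g∈b = complete g∈V in b , g∈b , block-unique c g∈b
      ; blockSize = λ b → length-tabulate (line c b)
      ; zeroSum   = λ b → trans (reflexive (foldr-tabulate _+_ 0# (line c b))) (line-sum c b)
      }
      where
      sound : ∀ b {g} → g ∈ block-of c b → g ∈ V
      sound b g∈b = let t , g≈l = ∈-block⁻ c b g∈b
                        i , j , l≈p = line⇒point c b t
                    in ∈V⁺ i j (trans g≈l l≈p)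

      complete : ∀ {g} → g ∈ V → ∃ λ b → g ∈ block-of c b
      complete g∈V = let i , j , g≈p = ∈V⁻ g∈V
                         b , t , p≈l = point⇒line c i j
                     in b , ∈-image⁺ {f-inj = λ {t} {t′} eq → proj₂ (line-injective c b b t t′ eq)} (t , trans g≈p p≈l)

    -- Within one class a single shared point identifies the block. Across classes
    -- `line-transversal` would force g = g′.
    blocks-linear : ∀ {g g′} → g ≉ g′ → ∀ {c b c′ b′} →
      g ∈ block-of c b → g′ ∈ block-of c b → g ∈ block-of c′ b′ → g′ ∈ block-of c′ b′ →
      _≡_ {A = Fin 4 × Fin k} (c , b) (c′ , b′)
    blocks-linear g≉g′ {c} {b} {c′} {b′} g∈B g′∈B g∈B′ g′∈B′ with c Fin.≟ c′
    ... | yes ≡.refl = ≡.cong (c ,_) (block-unique c g∈B g∈B′)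
    ... | no  c≢c′ =
      let t , g≈t = ∈-block⁻ c b g∈B
          s , g′≈s = ∈-block⁻ c b g′∈B
          t′ , g≈t′ = ∈-block⁻ c′ b′ g∈B′
          s′ , g′≈s′ = ∈-block⁻ c′ b′ g′∈B′
          t≡s = line-transversal c≢c′ (trans (sym g≈t) g≈t′) (trans (sym g′≈s) g′≈s′)
      in contradiction (trans g≈t (trans (reflexive (≡.cong (line c b) t≡s)) (sym g′≈s))) g≉g′

    net : HeffterNet c ℓ v k 4
    net = record
      { group   = +-abelianGroup
      ; v≡k²    = v≡k²
      ; V       = V
      ; halfSet = V-isHalfSet
      ; class   = system
      ; linear  = λ g≉g′ B B′ → blocks-linear g≉g′
      }

-- The case k = 3n, v = 9n² over a field.

theorem5p1 : ∀ {c ℓ₁ ℓ₂} (n q : ℕ) → n % 2 ≡ 1 →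
    q ≡ 18 ℕ.* n ℕ.^ 2 ℕ.+ 1 → IsPrimePower q →
    (F : HeytingField c ℓ₁ ℓ₂) →
    let open FieldNotions F in
    HasOrder setoid q →
    (x x⁻¹ : Carrier) → IsPrimitiveRootOfUnity (3 ℕ.* n) x → x * x⁻¹ ≈ 1# →
    (y : Fin (3 ℕ.* n) → Carrier) → IsCosetRepresentatives (3 ℕ.* n) y →
    sum y ≈ 0# →
    sum (λ i → x ^ toℕ i * y i) ≈ 0# →
    sum (λ i → x⁻¹ ^ toℕ i * y i) ≈ 0# →
    HeffterNet c ℓ₁ (9 ℕ.* n ℕ.^ 2) (3 ℕ.* n) 4
theorem5p1 n q n-odd q≡18n²+1 _ F order x x⁻¹ (xᵏ≈1 , xʲ≉1) x*x⁻¹≈1 y (y≉0 , coset) =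
  Net.net commutativeRing no-zero-divisors (3 ℕ.* n) h 3n≡1+2h 1<3n _ (9n²≡[3n]² n)
    (≡.subst (HasOrder setoid) q≡2v+1 order) x x⁻¹ xᵏ≈1 xʲ≉1 x*x⁻¹≈1 y y≉0 reps
  where
  open FieldNotions F

  m = n / 2
  -- With n = 1 + 2m one has 3n = 3 + 6m = 1 + 2(1 + 3m).
  h = 1 ℕ.+ 3 ℕ.* m

  n≡1+2m : n ≡ 1 ℕ.+ m ℕ.* 2
  n≡1+2m = ≡.trans (m≡m%n+[m/n]*n n 2) (≡.cong (ℕ._+ m ℕ.* 2) n-odd)

  3n≡1+2h : 3 ℕ.* n ≡ suc (2 ℕ.* h)
  3n≡1+2h = ≡.trans (≡.cong (3 ℕ.*_) n≡1+2m) (lemma m)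
    where
    lemma : ∀ m → 3 ℕ.* (1 ℕ.+ m ℕ.* 2) ≡ suc (2 ℕ.* (1 ℕ.+ 3 ℕ.* m))
    lemma = solve-∀

  1<3n : 1 ℕ.< 3 ℕ.* n
  1<3n = ≡.subst (1 ℕ.<_) (≡.sym 3n≡1+2h) (ℕ.s≤s (ℕ.s≤s ℕ.z≤n))

  9n²≡[3n]² : ∀ n → 9 ℕ.* (n ℕ.* (n ℕ.* 1)) ≡ 3 ℕ.* n ℕ.* (3 ℕ.* n ℕ.* 1)
  9n²≡[3n]² = solve-∀

  q≡2v+1 : q ≡ 2 ℕ.* (9 ℕ.* n ℕ.^ 2) ℕ.+ 1
  q≡2v+1 = ≡.trans q≡18n²+1 (lemma n)
    where
    lemma : ∀ n → 18 ℕ.* (n ℕ.* (n ℕ.* 1)) ℕ.+ 1 ≡ 2 ℕ.* (9 ℕ.* (n ℕ.* (n ℕ.* 1))) ℕ.+ 1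
    lemma = solve-∀

  reps : ∀ g → g ≉ 0# → ∃ λ i → ∃ λ z → z ≉ 0# × g ≈ y i * z ^ (3 ℕ.* n)
  reps g g≉0 =
    let i , (a , (z , z≉0 , a≈zᵏ) , g≈ya) , _ = coset g g≉0
    in i , z , z≉0 , CommutativeRing.trans commutativeRing g≈ya (CommutativeRing.*-congˡ commutativeRing a≈zᵏ)

  -- By tightness b = 0 follows once b # 0 is refuted. Given b # 0, also a # 0 is impossible, as ab
  -- would be apart from 0; so a = 0 by tightness again, against a ≠ 0.
  no-zero-divisors : NoZeroDivisors commutativeRing
  no-zero-divisors {a} {b} a≉0 ab≈0 = proj₁ (tight b 0#) λ b#0 →
    a≉0 (proj₁ (tight a 0#) λ a#0 → proj₂ (tight (a * b) 0#) ab≈0 (x#0y#0→xy#0 a#0 b#0))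
    where
    open HeytingField F using (tight)
    open import Algebra.Apartness.Properties.HeytingCommutativeRing heytingCommutativeRing
      using (x#0y#0→xy#0)
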